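{- Let $b\geq 3$ be an integer such that $b+1$ is not a power of $2$, and let $\alpha$ be an integer with $\alpha\neq 0$. Let $q\geq 5$ be a prime. Let $\mathcal{C}_1$ be a $b$-primitive covering system consisting of exactly one congruence for each of the moduli $2^j$ with $1\leq j\leq q$ and $2^jq$ with $0\leq j\leq q$, and let $\mathcal{C}_2$ be a $b$-primitive covering system consisting of exactly one congruence for each of the moduli $2^j3^{i}q^{j'}$ with $0\leq j\leq q$, $1\leq i\leq q$, and $0\leq j'\leq 1$. Let $\mathcal{P}_b(\mathcal{C}_1)$ and $\mathcal{P}_b(\mathcal{C}_2)$ be associated sets of primitive prime divisors, and let $M=\operatorname{lcm}\left(\{2^q,\,3^q,\,b-1,\,q\}\cup\mathcal{P}_b(\mathcal{C}_1)\cup\mathcal{P}_b(\mathcal{C}_2)\right)$. Then there exists an integer $T$ such that for all nonnegative integers $t\equiv T\pmod{M}$ with $(tb^t+\alpha)b+1\geq\max\left(\mathcal{P}_b(\mathcal{C}_1)\cup\mathcal{P}_b(\mathcal{C}_2)\right)$, the number $tb^t+\alpha$ is a $b$-Brier number.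
   Context: Let $b\geq 2$ be an integer. A positive integer $k$ is a $b$-Sierpiński number if $\gcd(k+1,b-1)=1$ and $k\cdot b^n+1$ is composite for all positive integers $n$. A positive integer $k$ is a $b$-Riesel number if $\gcd(k-1,b-1)=1$ and $k\cdot b^n-1$ is composite for all positive integers $n$. A $b$-Brier number is a number that is both $b$-Sierpiński and $b$-Riesel. A covering system (of the integers) is a finite collection of congruences $r_i\pmod{m_i}$, $1\le i\le \nu$, such that every integer $n$ satisfies $n\equiv r_i\pmod{m_i}$ for at least one $i$. For an integer $w\geq 1$, a prime $p$ is a primitive prime divisor of $b^w-1$ if $p\mid b^w-1$ and $p\nmid b^\ell-1$ for all $1\leq \ell<w$. A covering system $\mathcal{C}=\{r_i\pmod{m_i}:1\leq i\leq\nu\}$ is called $b$-primitive if there exist distinct primes $p_1,\ldots,p_\nu$ such that, for each $i$, $p_i$ is a primitive prime divisor of $b^{m_i}-1$. For a $b$-primitive covering system $\mathcal{C}$, $\mathcal{P}_b(\mathcal{C})=\{p_1,\ldots,p_\nu\}$ denotes a (fixed, arbitrary) choice of such primes. -}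

module Defs where

open import Data.Integer as ℤ using (ℤ; +_; 0ℤ; 1ℤ; ∣_∣)
import Data.Integer.Divisibility as ℤ
import Data.Integer.GCD as ℤ
open import Data.List.Base using (List; map; foldr; upTo; _++_; cartesianProductWith)
open import Data.List.Relation.Binary.Pointwise using (Pointwise)
open import Data.List.Relation.Unary.Any using (Any)
open import Data.List.Relation.Unary.Unique.Propositional using (Unique)
open import Data.Nat.Base using (ℕ; suc; _*_; _∸_; _^_; _≤_; _<_; NonZero)
open import Data.Nat.Divisibility using (_∣_)
open import Data.Nat.LCM using (lcm)
open import Data.Nat.Primality using (Prime; Composite)
open import Data.Product.Base using (_×_)
open import Relation.Binary.PropositionalEquality using (_≡_)
open import Relation.Nullary using (¬_)

infix 4 _≡_[mod_]

_≡_[mod_] : ℤ → ℤ → ℕ → Set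
x ≡ y [mod m ] = + m ℤ.∣ x ℤ.- y

-- Numbers are taken in ℤ so that an expression such as t bᵗ + α can be tested
-- directly.  Since k > 0 and b ≥ 2, the integers k bⁿ ± 1 are nonnegative, so
-- the absolute value only converts them to ℕ.

record IsSierpiński (b : ℕ) (k : ℤ) : Set where
  field
    positive  : 0ℤ ℤ.< k
    coprime   : ℤ.gcd (k ℤ.+ 1ℤ) (+ b ℤ.- 1ℤ) ≡ 1ℤ
    composite : ∀ n → 1 ≤ n → Composite ∣ k ℤ.* + (b ^ n) ℤ.+ 1ℤ ∣

record IsRiesel (b : ℕ) (k : ℤ) : Set where
  field
    positive  : 0ℤ ℤ.< k
    coprime   : ℤ.gcd (k ℤ.- 1ℤ) (+ b ℤ.- 1ℤ) ≡ 1ℤ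
    composite : ∀ n → 1 ≤ n → Composite ∣ k ℤ.* + (b ^ n) ℤ.- 1ℤ ∣

IsBrier : ℕ → ℤ → Set
IsBrier b k = IsSierpiński b k × IsRiesel b k

record Congruence : Set where
  field
    residue         : ℤ
    modulus         : ℕ
    .{{modulus≢0}}  : NonZero modulus

open Congruence public

record CoveringSystem : Set where
  field
    congruences : List Congruence
    covers      : ∀ n → Any (λ c → n ≡ residue c [mod modulus c ]) congruences

  moduli : List ℕ
  moduli = map modulus congruences

open CoveringSystem public

-- For b ≥ 1 the truncated subtraction b ^ w ∸ 1 is exact.
record IsPrimitivePrimeDivisor (b w p : ℕ) : Set where
  field
    isPrime   : Prime p
    divides   : p ∣ b ^ w ∸ 1
    minimal   : ∀ ℓ → 1 ≤ ℓ → ℓ < w → ¬ p ∣ b ^ ℓ ∸ 1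

-- A system is b-primitive when this type is inhabited; an inhabitant carries
-- the chosen primes 𝒫_b(C), listed in the order of the congruences.
record Primitive (b : ℕ) (C : CoveringSystem) : Set where
  field
    primes         : List ℕ
    primesDistinct : Unique primes
    primitivePrime : Pointwise (IsPrimitivePrimeDivisor b) (moduli C) primes

open Primitive public

[0⋯_] : ℕ → List ℕ
[0⋯ n ] = upTo (suc n)

[1⋯_] : ℕ → List ℕ
[1⋯ n ] = map suc (upTo n)

moduli₁ : ℕ → List ℕ
moduli₁ q = map (λ j → 2 ^ j) [1⋯ q ] ++ map (λ j → 2 ^ j * q) [0⋯ q ]

moduli₂ : ℕ → List ℕ
moduli₂ q = cartesianProductWith _*_
  (cartesianProductWith (λ j i → 2 ^ j * 3 ^ i) [0⋯ q ] [1⋯ q ])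
  (map (λ j′ → q ^ j′) [0⋯ 1 ])

lcmList : List ℕ → ℕ
lcmList = foldr lcm 1

{-# OPTIONS --safe #-}

-- For each congruence r (mod m) with its prime p, the requirement p ∣ k bⁿ ± 1 for all
-- n ≡ r (mod m) is a condition on k = t bᵗ + α modulo p.  Since the order m of b modulo p
-- is less than p, such conditions can be imposed on t one prime at a time, in increasing
-- order of p: t modulo m is settled before t modulo p is chosen.
--
-- A prime divisor p of k bⁿ ± 1 proves compositeness unless it equals k bⁿ ± 1, and when
-- max 𝒫 ≤ k b + 1 this forces ∣ k b - max 𝒫 ∣ ≤ 1.  As b ≥ 3, at most one t is bad in this
-- sense.  The prescription of t modulo 2^q and b - 1 leaves at least two classes
-- modulo M, and one of them contains no bad t.
module Submission where

open import Defs
open import Data.Fin.Base as Fin using (Fin; toℕ; fromℕ<)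
open import Data.Fin.Properties using (pigeonhole; toℕ-fromℕ<; toℕ<n)
open import Data.Integer as ℤ using (ℤ; +_; -[1+_]; +<+; 0ℤ; 1ℤ; ∣_∣)
import Data.Integer.Properties as ℤ
import Data.Integer.GCD as ℤ
open import Data.Integer.Divisibility.Signed as ℤ using () renaming (_∣_ to _∣ᶻ_)
open import Data.Integer.DivMod using (_%ℕ_; _/ℕ_; a≡a%ℕn+[a/ℕn]*n)
open import Data.Integer.Tactic.RingSolver using (solve-∀)
open import Data.List.Base using (List; []; _∷_; _++_; map; cartesianProductWith)
open import Data.List.Extrema.Nat using (max; xs≤max)
open import Data.List.Membership.Propositional using (_∈_; find; lose)
open import Data.List.Membership.Propositional.Properties using (∈-map⁺; ∈-map⁻; ∈-++⁺ˡ; ∈-++⁺ʳ; ∈-++⁻; ∈-upTo⁻; ∈-cartesianProductWith⁻)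
open import Data.List.Properties using (map-++)
open import Data.List.Relation.Binary.Disjoint.Propositional using (Disjoint)
open import Data.List.Relation.Binary.Permutation.Propositional using (_↭_)
open import Data.List.Relation.Binary.Permutation.Propositional.Properties using (∈-resp-↭)
open import Data.List.Relation.Binary.Pointwise using (Pointwise; []; _∷_)
open import Data.List.Relation.Unary.All as All using ()
open import Data.List.Relation.Unary.AllPairs using (_∷_)
open import Data.List.Relation.Unary.Any using (here; there; any?)
open import Data.List.Relation.Unary.Unique.Propositional using (Unique)
import Data.List.Relation.Unary.Unique.Propositional.Properties as Unique
open import Data.Nat.Base
open import Data.Nat.Coprimality as Coprime using (Coprime; coprime-Bézout; coprime-divisor)
open import Data.Nat.DivMod using (_/_; _%_; m%n<n; m≡m%n+[m/n]*n)
open import Data.Nat.Divisibility as ℕ using (_∣_)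
open import Data.Nat.GCD using (module Bézout; gcd; gcd[m,n]∣m; gcd[m,n]∣n)
open import Data.Nat.LCM using (m∣lcm[m,n]; n∣lcm[m,n])
open import Data.Nat.Primality using (Prime; Composite; prime?; prime[2]; ¬prime[1]; euclidsLemma; prime⇒irreducible; prime⇒nonZero; prime⇒nonTrivial; composite-≢)
open import Data.Nat.Properties
open import Data.Product.Base using (Σ-syntax; ∃; _×_; _,_; proj₁; proj₂)
open import Data.Sum.Base using (inj₁; inj₂; [_,_]′)
open import Function.Base using (id; _∘_)
open import Relation.Binary.Definitions using (tri<; tri≈; tri>)
open import Relation.Binary.PropositionalEquality
open import Relation.Nullary
open import Relation.Nullary.Decidable using (_×-dec_; from-yes; from-no)

-- Congruences of integers and natural representatives.

infixl 6 _-ᴺ_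
_-ᴺ_ : ℕ → ℕ → ℤ
m -ᴺ n = + m ℤ.- + n

∣-resp-≡ : ∀ {d x y} → x ≡ y → d ∣ᶻ x → d ∣ᶻ y
∣-resp-≡ refl d∣x = d∣x

lift : ∀ {d n} → d ∣ n → + d ∣ᶻ + n
lift = ℤ.∣ᵤ⇒∣

lower : ∀ {d n} → + d ∣ᶻ + n → d ∣ n
lower = ℤ.∣⇒∣ᵤ

∣ᶻ-sym : ∀ {d} x y → d ∣ᶻ x ℤ.- y → d ∣ᶻ y ℤ.- x
∣ᶻ-sym x y = ∣-resp-≡ (swap x y) ∘ ℤ.∣m⇒∣-m
  where
  swap : ∀ x y → ℤ.- (x ℤ.- y) ≡ y ℤ.- x
  swap = solve-∀

∣ᶻ-trans : ∀ {d} x y z → d ∣ᶻ x ℤ.- y → d ∣ᶻ y ℤ.- z → d ∣ᶻ x ℤ.- z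
∣ᶻ-trans x y z p q = ∣-resp-≡ (telescope x y z) (ℤ.∣m∣n⇒∣m+n p q)
  where
  telescope : ∀ x y z → x ℤ.- y ℤ.+ (y ℤ.- z) ≡ x ℤ.- z
  telescope = solve-∀

∸1-exact : ∀ {n} → 1 ≤ n → n -ᴺ 1 ≡ + (n ∸ 1)
∸1-exact (s≤s _) = refl

natural-representative : ∀ N .{{_ : NonZero N}} z → ∃ λ n → + N ∣ᶻ + n ℤ.- z
natural-representative N z = z %ℕ N , ℤ.divides (ℤ.- (z /ℕ N)) (begin
  + (z %ℕ N) ℤ.- z                                   ≡⟨ cong (λ x → + (z %ℕ N) ℤ.- x) (a≡a%ℕn+[a/ℕn]*n z N) ⟩
  + (z %ℕ N) ℤ.- (+ (z %ℕ N) ℤ.+ (z /ℕ N) ℤ.* + N)   ≡⟨ cancel (+ (z %ℕ N)) (z /ℕ N) (+ N) ⟩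
  ℤ.- (z /ℕ N) ℤ.* + N                               ∎)
  where
  open ≡-Reasoning
  cancel : ∀ r k n → r ℤ.- (r ℤ.+ k ℤ.* n) ≡ ℤ.- k ℤ.* n
  cancel = solve-∀

-- Linear congruences modulo a prime; prime divisors of powers and factorials.

prime∤⇒coprime : ∀ {p a} → Prime p → ¬ p ∣ a → Coprime p a
prime∤⇒coprime p-prime p∤a (i∣p , i∣a) with prime⇒irreducible p-prime i∣p
... | inj₁ i≡1  = i≡1
... | inj₂ refl = contradiction i∣a p∤a

inverse-mod : ∀ {p a} → Coprime p a → ∃ λ u → + p ∣ᶻ + a ℤ.* u ℤ.- 1ℤ
inverse-mod {p} {a} c with coprime-Bézout c
... | Bézout.+- x y eq = ℤ.- + y , ℤ.divides (ℤ.- + x) (begin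
    + a ℤ.* ℤ.- + y ℤ.- 1ℤ      ≡⟨ shuffle (+ a) (+ y) ⟩
    ℤ.- (1ℤ ℤ.+ + y ℤ.* + a)    ≡⟨ cong (λ z → ℤ.- (1ℤ ℤ.+ z)) (ℤ.pos-* y a) ⟨
    ℤ.- + (1 + y * a)           ≡⟨ cong (λ z → ℤ.- + z) eq ⟩
    ℤ.- + (x * p)               ≡⟨ cong ℤ.-_ (ℤ.pos-* x p) ⟩
    ℤ.- (+ x ℤ.* + p)           ≡⟨ ℤ.neg-distribˡ-* (+ x) (+ p) ⟩
    ℤ.- + x ℤ.* + p             ∎)
  where
  open ≡-Reasoning
  shuffle : ∀ a y → a ℤ.* ℤ.- y ℤ.- 1ℤ ≡ ℤ.- (1ℤ ℤ.+ y ℤ.* a)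
  shuffle = solve-∀
... | Bézout.-+ x y eq = + y , ℤ.divides (+ x) (begin
    + a ℤ.* + y ℤ.- 1ℤ          ≡⟨ cong (ℤ._- 1ℤ) (ℤ.*-comm (+ a) (+ y)) ⟩
    + y ℤ.* + a ℤ.- 1ℤ          ≡⟨ cong (ℤ._- 1ℤ) (ℤ.pos-* y a) ⟨
    + (y * a) ℤ.- 1ℤ            ≡⟨ cong (λ z → + z ℤ.- 1ℤ) eq ⟨
    + (1 + x * p) ℤ.- 1ℤ        ≡⟨⟩
    + (x * p)                   ≡⟨ ℤ.pos-* x p ⟩
    + x ℤ.* + p                 ∎)
  where open ≡-Reasoning

-- With u an inverse of a modulo p, take s ≡ - u c. A natural s is chosen because it will enter an
-- exponent of b.
linear-congruence : ∀ {p a} → Prime p → ¬ p ∣ a → ∀ c → ∃ λ s → + p ∣ᶻ + a ℤ.* + s ℤ.+ c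
linear-congruence {p} {a} p-prime p∤a c
  with u , p∣au-1 ← inverse-mod (prime∤⇒coprime p-prime p∤a)
  with s , p∣s+uc ← natural-representative p {{prime⇒nonZero p-prime}} (ℤ.- (u ℤ.* c))
  = s , ∣-resp-≡ (expand (+ a) (+ s) u c)
      (ℤ.∣m∣n⇒∣m-n (ℤ.∣n⇒∣m*n (+ a) p∣s+uc) (ℤ.∣n⇒∣m*n c p∣au-1))
  where
  expand : ∀ a s u c → a ℤ.* (s ℤ.- ℤ.- (u ℤ.* c)) ℤ.- c ℤ.* (a ℤ.* u ℤ.- 1ℤ) ≡ a ℤ.* s ℤ.+ c
  expand = solve-∀

prime∣^⇒prime∣ : ∀ {p} → Prime p → ∀ b n → p ∣ b ^ n → p ∣ b
prime∣^⇒prime∣ p-prime b zero p∣1 = contradiction (ℕ.∣1⇒≡1 p∣1) λ { refl → ¬prime[1] p-prime }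
prime∣^⇒prime∣ p-prime b (suc n) p∣ = [ id , prime∣^⇒prime∣ p-prime b n ]′ (euclidsLemma b (b ^ n) p-prime p∣)

prime∣!⇒≤ : ∀ {p} → Prime p → ∀ n → p ∣ n ! → p ≤ n
prime∣!⇒≤ p-prime zero p∣1 = contradiction (ℕ.∣1⇒≡1 p∣1) λ { refl → ¬prime[1] p-prime }
prime∣!⇒≤ p-prime (suc n) p∣ = [ ℕ.∣⇒≤ , m≤n⇒m≤1+n ∘ prime∣!⇒≤ p-prime n ]′ (euclidsLemma (suc n) (n !) p-prime p∣)

n∣m! : ∀ {n m} → 1 ≤ n → n ≤ m → n ∣ m !
n∣m! {suc n} {m} _ n≤m = ℕ.∣-trans (ℕ.m∣m*n (n !)) (ℕ.m≤n⇒m!∣n! n≤m)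

-- Powers modulo an integer.

^-≡1 : ∀ {d x} → d ∣ᶻ x -ᴺ 1 → ∀ s → d ∣ᶻ x ^ s -ᴺ 1
^-≡1 d∣ zero = ℤ.divides 0ℤ refl
^-≡1 {d} {x} d∣ (suc s) = ∣-resp-≡ eq (ℤ.∣m∣n⇒∣m+n (ℤ.∣n⇒∣m*n (+ x) (^-≡1 d∣ s)) d∣)
  where
  expand : ∀ x y → x ℤ.* (y ℤ.- 1ℤ) ℤ.+ (x ℤ.- 1ℤ) ≡ x ℤ.* y ℤ.- 1ℤ
  expand = solve-∀
  eq : + x ℤ.* (x ^ s -ᴺ 1) ℤ.+ (x -ᴺ 1) ≡ x ^ suc s -ᴺ 1
  eq = trans (expand (+ x) (+ (x ^ s))) (cong (ℤ._- 1ℤ) (sym (ℤ.pos-* x (x ^ s))))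

+-cancel-ᶻ : ∀ t d → (t + d) -ᴺ t ≡ + d
+-cancel-ᶻ t d = trans (cong (ℤ._- + t) (ℤ.pos-+ t d)) (cancel (+ t) (+ d))
  where
  cancel : ∀ t d → t ℤ.+ d ℤ.- t ≡ d
  cancel = solve-∀

^-+-difference : ∀ b t d → b ^ (t + d) -ᴺ b ^ t ≡ + (b ^ t) ℤ.* (b ^ d -ᴺ 1)
^-+-difference b t d = trans
  (cong (ℤ._- + (b ^ t)) (trans (cong +_ (^-distribˡ-+-* b t d)) (ℤ.pos-* (b ^ t) (b ^ d))))
  (factor (+ (b ^ t)) (+ (b ^ d)))
  where
  factor : ∀ x y → x ℤ.* y ℤ.- x ≡ x ℤ.* (y ℤ.- 1ℤ)
  factor = solve-∀

-- The difference factors as b^t (b^(t′ - t) - 1), and b^(t′ - t) is a power of b^m ≡ 1.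
^-cong-mod-≤ : ∀ {p b m t t′} → + p ∣ᶻ b ^ m -ᴺ 1 → t ≤ t′ → + m ∣ᶻ t′ -ᴺ t → + p ∣ᶻ b ^ t′ -ᴺ b ^ t
^-cong-mod-≤ {p} {b} {m} {t} p∣ t≤t′ m∣ with d , refl ← m≤n⇒∃[o]m+o≡n t≤t′
  with ℕ.divides s refl ← lower (∣-resp-≡ (+-cancel-ᶻ t d) m∣)
  = ∣-resp-≡ (sym (^-+-difference b t (s * m))) (ℤ.∣n⇒∣m*n (+ (b ^ t))
      (subst (λ z → + p ∣ᶻ z -ᴺ 1) (trans (^-*-assoc b m s) (cong (b ^_) (*-comm m s))) (^-≡1 p∣ s)))

^-cong-mod : ∀ {p b m} t t′ → + p ∣ᶻ b ^ m -ᴺ 1 → + m ∣ᶻ t -ᴺ t′ → + p ∣ᶻ b ^ t -ᴺ b ^ t′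
^-cong-mod {b = b} t t′ p∣ m∣ with ≤-total t t′
... | inj₁ t≤t′ = ∣ᶻ-sym (+ (b ^ t′)) (+ (b ^ t)) (^-cong-mod-≤ p∣ t≤t′ (∣ᶻ-sym (+ t) (+ t′) m∣))
... | inj₂ t′≤t = ^-cong-mod-≤ p∣ t′≤t m∣

-- The order of b modulo a primitive prime divisor.

module _ {b m p} (b>0 : 1 ≤ b) (primitivity : IsPrimitivePrimeDivisor b m p) where
  open IsPrimitivePrimeDivisor primitivity

  private
    instance
      p≢0 : NonZero p
      p≢0 = prime⇒nonZero isPrime
      b≢0 : NonZero b
      b≢0 = >-nonZero b>0

  p∣b^m-1 : + p ∣ᶻ b ^ m -ᴺ 1
  p∣b^m-1 = ∣-resp-≡ (sym (∸1-exact (m^n>0 b m))) (lift divides)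

  -- Since m ≥ 1, a prime dividing b would divide both b^m and b^m - 1, hence 1.
  p∤b : 1 ≤ m → ¬ p ∣ b
  p∤b (s≤s {n = m′} _) p∣b = ¬prime[1] (subst Prime (ℕ.∣1⇒≡1 (lower p∣1)) isPrime)
    where
    cancel : ∀ x → x ℤ.- (x ℤ.- 1ℤ) ≡ 1ℤ
    cancel = solve-∀
    p∣1 : + p ∣ᶻ 1ℤ
    p∣1 = ∣-resp-≡ (cancel (+ (b ^ m))) (ℤ.∣m∣n⇒∣m-n (lift (ℕ.∣m⇒∣m*n (b ^ m′) p∣b)) p∣b^m-1)

  -- If m ≥ p, two of the p + 1 numbers 0, b⁰, …, b^(p-1) agree modulo p, against p ∤ b or
  -- the minimality of m.
  order<prime : 1 ≤ m → m < p
  order<prime m≥1 with <-≤-connex m p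
  ... | inj₁ m<p = m<p
  ... | inj₂ p≤m = contradiction (pigeonhole (n<1+n p) (λ i → fromℕ< (m%n<n (value i) p))) collision
    where
    value : Fin (suc p) → ℕ
    value Fin.zero    = 0
    value (Fin.suc i) = b ^ toℕ i

    %-≡⇒∣ : ∀ x y → x % p ≡ y % p → + p ∣ᶻ x -ᴺ y
    %-≡⇒∣ x y eq = ℤ.divides (+ (x / p) ℤ.- + (y / p)) (begin
      + x ℤ.- + y ≡⟨ cong₂ ℤ._-_ (split x) (split y) ⟩
      (+ (x % p) ℤ.+ + (x / p) ℤ.* + p) ℤ.- (+ (y % p) ℤ.+ + (y / p) ℤ.* + p)
        ≡⟨ cong (λ z → (+ z ℤ.+ + (x / p) ℤ.* + p) ℤ.- (+ (y % p) ℤ.+ + (y / p) ℤ.* + p)) eq ⟩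
      (+ (y % p) ℤ.+ + (x / p) ℤ.* + p) ℤ.- (+ (y % p) ℤ.+ + (y / p) ℤ.* + p)
        ≡⟨ collect (+ (y % p)) (+ (x / p)) (+ (y / p)) (+ p) ⟩
      (+ (x / p) ℤ.- + (y / p)) ℤ.* + p ∎)
      where
      open ≡-Reasoning
      collect : ∀ r x y p → (r ℤ.+ x ℤ.* p) ℤ.- (r ℤ.+ y ℤ.* p) ≡ (x ℤ.- y) ℤ.* p
      collect = solve-∀
      split : ∀ x → + x ≡ + (x % p) ℤ.+ + (x / p) ℤ.* + p
      split x = trans (cong +_ (m≡m%n+[m/n]*n x p))
        (trans (ℤ.pos-+ (x % p) (x / p * p)) (cong (λ z → + (x % p) ℤ.+ z) (ℤ.pos-* (x / p) p)))

    value-≡ : ∀ i j → fromℕ< (m%n<n (value i) p) ≡ fromℕ< (m%n<n (value j) p) → + p ∣ᶻ value j -ᴺ value i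
    value-≡ i j eq = %-≡⇒∣ (value j) (value i)
      (sym (trans (sym (toℕ-fromℕ< (m%n<n (value i) p))) (trans (cong toℕ eq) (toℕ-fromℕ< (m%n<n (value j) p)))))

    distinct : ∀ i j → i Fin.< j → ¬ + p ∣ᶻ value j -ᴺ value i
    distinct Fin.zero (Fin.suc j) _ p∣ =
      p∤b m≥1 (prime∣^⇒prime∣ isPrime b (toℕ j) (lower (∣-resp-≡ (ℤ.+-identityʳ _) p∣)))
    -- With d = j - i the difference is b^i (b^d - 1). Here 1 ≤ d ≤ j < p ≤ m, so minimality of m
    -- excludes the second factor.
    distinct (Fin.suc i) (Fin.suc j) (s≤s i<j) p∣ with d , i+d≡j ← m≤n⇒∃[o]m+o≡n (<⇒≤ i<j) =
      [ (λ p∣b^i → p∤b m≥1 (prime∣^⇒prime∣ isPrime b (toℕ i) p∣b^i))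
      , minimal d 1≤d (<-≤-trans (≤-<-trans (subst (d ≤_) i+d≡j (m≤n+m d (toℕ i))) (toℕ<n j)) p≤m)
      ]′ (euclidsLemma (b ^ toℕ i) (b ^ d ∸ 1) isPrime p∣product)
      where
      1≤d : 1 ≤ d
      1≤d = +-cancelˡ-< (toℕ i) 0 d (subst₂ _<_ (sym (+-identityʳ (toℕ i))) (sym i+d≡j) i<j)
      p∣product : p ∣ b ^ toℕ i * (b ^ d ∸ 1)
      p∣product = lower (∣-resp-≡
        (trans (cong (λ z → b ^ z -ᴺ b ^ toℕ i) (sym i+d≡j))
          (trans (^-+-difference b (toℕ i) d)
            (trans (cong (λ z → + (b ^ toℕ i) ℤ.* z) (∸1-exact (m^n>0 b d))) (sym (ℤ.pos-* (b ^ toℕ i) (b ^ d ∸ 1))))))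
        p∣)

    collision : ¬ (∃ λ i → ∃ λ j → i Fin.< j × fromℕ< (m%n<n (value i) p) ≡ fromℕ< (m%n<n (value j) p))
    collision (i , j , i<j , eq) = distinct i j i<j (value-≡ i j eq)

-- The smaller of two different exponents would contradict the minimality of the larger.
order-unique : ∀ {b m m′ p} → 1 ≤ m → 1 ≤ m′ →
  IsPrimitivePrimeDivisor b m p → IsPrimitivePrimeDivisor b m′ p → m ≡ m′
order-unique {m = m} {m′} m≥1 m′≥1 P P′ with <-cmp m m′
... | tri< m<m′ _ _ = contradiction (IsPrimitivePrimeDivisor.divides P) (IsPrimitivePrimeDivisor.minimal P′ m m≥1 m<m′)
... | tri≈ _ m≡m′ _ = m≡m′
... | tri> _ _ m>m′ = contradiction (IsPrimitivePrimeDivisor.divides P′) (IsPrimitivePrimeDivisor.minimal P m′ m′≥1 m>m′)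

-- Divisibility conditions on k and the sieve that meets all of them.

-- The sign is 1 for the Sierpiński conditions and -1 for the Riesel conditions, so one sieve can
-- treat both systems together.
record Clause (b : ℕ) : Set where
  field
    congruence   : Congruence
    sign         : ℤ
    prime        : ℕ
    modulus>1    : 1 < modulus congruence
    primitivity  : IsPrimitivePrimeDivisor b (modulus congruence) prime

  order : ℕ
  order = modulus congruence

  order≥1 : 1 ≤ order
  order≥1 = <⇒≤ modulus>1

  isPrime : Prime prime
  isPrime = IsPrimitivePrimeDivisor.isPrime primitivity

module Sieve (b : ℕ) (b>0 : 1 ≤ b) (α : ℤ) where
  open Clause

  k : ℕ → ℤ
  k t = + (t * b ^ t) ℤ.+ α

  k-cong-mod : ∀ {d} t t′ → d ∣ᶻ t -ᴺ t′ → d ∣ᶻ b ^ t -ᴺ b ^ t′ → d ∣ᶻ k t ℤ.- k t′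
  k-cong-mod t t′ d∣t-t′ d∣b^t-b^t′ = ∣-resp-≡ eq
    (ℤ.∣m∣n⇒∣m+n (ℤ.∣n⇒∣m*n (+ t) d∣b^t-b^t′) (ℤ.∣m⇒∣m*n (+ (b ^ t′)) d∣t-t′))
    where
    expand : ∀ t t′ x x′ a → t ℤ.* (x ℤ.- x′) ℤ.+ (t ℤ.- t′) ℤ.* x′ ≡ (t ℤ.* x ℤ.+ a) ℤ.- (t′ ℤ.* x′ ℤ.+ a)
    expand = solve-∀
    eq : + t ℤ.* (b ^ t -ᴺ b ^ t′) ℤ.+ (t -ᴺ t′) ℤ.* + (b ^ t′) ≡ k t ℤ.- k t′
    eq = trans (expand (+ t) (+ t′) (+ (b ^ t)) (+ (b ^ t′)) α)
      (cong₂ (λ x y → (x ℤ.+ α) ℤ.- (y ℤ.+ α)) (sym (ℤ.pos-* t (b ^ t))) (sym (ℤ.pos-* t′ (b ^ t′))))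

  Satisfies : Clause b → ℕ → Set
  Satisfies e t = ∀ n → + n ≡ residue (congruence e) [mod order e ] → + prime e ∣ᶻ k t ℤ.* + (b ^ n) ℤ.+ sign e

  power-periodic : ∀ e t t′ → + order e ∣ᶻ t -ᴺ t′ → + prime e ∣ᶻ b ^ t -ᴺ b ^ t′
  power-periodic e t t′ = ^-cong-mod t t′ (p∣b^m-1 b>0 (primitivity e))

  -- Modulo p, the factor t of t b^t depends on t modulo p, and the factor b^t on t modulo the order
  -- of b. Both residues must therefore be kept.
  satisfies-cong : ∀ e t t′ → + prime e ∣ᶻ t -ᴺ t′ → + order e ∣ᶻ t -ᴺ t′ → Satisfies e t′ → Satisfies e t
  satisfies-cong e t t′ p∣ m∣ sat n n≡r = ∣-resp-≡ (expand (k t) (k t′) (+ (b ^ n)) (sign e))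
    (ℤ.∣m∣n⇒∣m+n (ℤ.∣m⇒∣m*n (+ (b ^ n)) (k-cong-mod t t′ p∣ (power-periodic e t t′ m∣))) (sat n n≡r))
    where
    expand : ∀ k k′ x ε → (k ℤ.- k′) ℤ.* x ℤ.+ (k′ ℤ.* x ℤ.+ ε) ≡ k ℤ.* x ℤ.+ ε
    expand = solve-∀

  -- Adding multiples of N keeps t in its class modulo the order, so b^t stays b^T modulo p.
  -- Likewise b^n may be replaced by b^r for a fixed natural r in the residue class. The condition
  -- then becomes linear in s, with constant term `c` and leading coefficient N b^T b^r, which is
  -- invertible modulo p.
  satisfiable : ∀ e {N} → order e ∣ N → ¬ prime e ∣ N → ∀ T → ∃ λ s → Satisfies e (T + N * s)
  satisfiable e {N} m∣N p∤N T = s , satisfied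
    where
    p = prime e
    p-prime = isPrime e
    instance
      order≢0 : NonZero (order e)
      order≢0 = >-nonZero (order≥1 e)

    r = proj₁ (natural-representative (order e) (residue (congruence e)))
    r≡residue = proj₂ (natural-representative (order e) (residue (congruence e)))

    p∤b^ : ∀ n → ¬ p ∣ b ^ n
    p∤b^ n = p∤b b>0 (primitivity e) (order≥1 e) ∘ prime∣^⇒prime∣ p-prime b n

    p∤a : ¬ p ∣ N * (b ^ T * b ^ r)
    p∤a = [ p∤N , [ p∤b^ T , p∤b^ r ]′ ∘ euclidsLemma (b ^ T) (b ^ r) p-prime ]′
        ∘ euclidsLemma N (b ^ T * b ^ r) p-prime

    c = (+ T ℤ.* + (b ^ T) ℤ.+ α) ℤ.* + (b ^ r) ℤ.+ sign e

    s = proj₁ (linear-congruence p-prime p∤a c)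
    p∣as+c = proj₂ (linear-congruence p-prime p∤a c)

    T′ = T + N * s

    m∣T′-T : + order e ∣ᶻ T′ -ᴺ T
    m∣T′-T = ∣-resp-≡ (sym (+-cancel-ᶻ T (N * s))) (lift (ℕ.∣m⇒∣m*n s m∣N))

    T′≡ : + T′ ≡ + T ℤ.+ + N ℤ.* + s
    T′≡ = trans (ℤ.pos-+ T (N * s)) (cong (λ z → + T ℤ.+ z) (ℤ.pos-* N s))

    a≡ : + (N * (b ^ T * b ^ r)) ≡ + N ℤ.* (+ (b ^ T) ℤ.* + (b ^ r))
    a≡ = trans (ℤ.pos-* N _) (cong (λ z → + N ℤ.* z) (ℤ.pos-* (b ^ T) (b ^ r)))

    satisfied : Satisfies e T′
    -- The first summand replaces b^T′ by b^T, the second replaces b^n by b^r, and the last is the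
    -- linear expression that `s` solves.
    satisfied n n≡residue = ∣-resp-≡ eq
      (ℤ.∣m∣n⇒∣m+n
        (ℤ.∣m∣n⇒∣m+n (ℤ.∣m⇒∣m*n (+ T′ ℤ.* + (b ^ n)) (power-periodic e T′ T m∣T′-T))
          (ℤ.∣n⇒∣m*n (+ T′ ℤ.* + (b ^ T) ℤ.+ α) (power-periodic e n r n≡r)))
        p∣as+c)
      where
      n≡r : + order e ∣ᶻ n -ᴺ r
      n≡r = ∣ᶻ-trans (+ n) (residue (congruence e)) (+ r) (ℤ.∣ᵤ⇒∣ n≡residue)
        (∣ᶻ-sym (+ r) (residue (congruence e)) r≡residue)
      expand : ∀ T N s a x y z u ε → let T′ = T ℤ.+ N ℤ.* s in
        ((x ℤ.- y) ℤ.* (T′ ℤ.* z) ℤ.+ (T′ ℤ.* y ℤ.+ a) ℤ.* (z ℤ.- u))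
          ℤ.+ ((N ℤ.* (y ℤ.* u)) ℤ.* s ℤ.+ ((T ℤ.* y ℤ.+ a) ℤ.* u ℤ.+ ε))
        ≡ (T′ ℤ.* x ℤ.+ a) ℤ.* z ℤ.+ ε
      expand = solve-∀
      eq : ((b ^ T′ -ᴺ b ^ T) ℤ.* (+ T′ ℤ.* + (b ^ n)) ℤ.+ (+ T′ ℤ.* + (b ^ T) ℤ.+ α) ℤ.* (b ^ n -ᴺ b ^ r))
             ℤ.+ (+ (N * (b ^ T * b ^ r)) ℤ.* + s ℤ.+ c)
         ≡ k T′ ℤ.* + (b ^ n) ℤ.+ sign e
      eq = trans
        (cong₂ (λ w v → ((b ^ T′ -ᴺ b ^ T) ℤ.* (w ℤ.* + (b ^ n)) ℤ.+ (w ℤ.* + (b ^ T) ℤ.+ α) ℤ.* (b ^ n -ᴺ b ^ r))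
             ℤ.+ (v ℤ.* + s ℤ.+ c)) T′≡ a≡)
        (trans (expand (+ T) (+ N) (+ s) α (+ (b ^ T′)) (+ (b ^ T)) (+ (b ^ n)) (+ (b ^ r)) (sign e))
          (cong (λ w → (w ℤ.+ α) ℤ.* + (b ^ n) ℤ.+ sign e)
            (trans (cong (ℤ._* + (b ^ T′)) (sym T′≡)) (sym (ℤ.pos-* T′ (b ^ T′))))))

  -- The order of b modulo a prime p is less than p, so it divides (p - 1)!, and hence
  -- the primes can be treated in increasing order, moving T by a multiple of N₀ (p - 1)!
  -- when p is reached.
  sieve : (E : List (Clause b)) →
    (∀ {e e′} → e ∈ E → e′ ∈ E → prime e ≡ prime e′ → e ≡ e′) →
    ∀ {N₀} → (∀ {e} → e ∈ E → ¬ prime e ∣ N₀) → ∀ T₀ x →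
    ∃ λ T → + N₀ ∣ᶻ T -ᴺ T₀ × (∀ {e} → e ∈ E → prime e ≤ x → Satisfies e T)
  sieve E unique {N₀} p∤N₀ T₀ zero =
    T₀ , ∣-resp-≡ (sym (ℤ.+-inverseʳ (+ T₀))) (ℤ.divides 0ℤ refl) ,
    λ {e} _ p≤0 → contradiction (order<prime b>0 (primitivity e) (order≥1 e)) (≤⇒≯ (≤-trans p≤0 z≤n))
  sieve E unique {N₀} p∤N₀ T₀ (suc x)
    with T , T≡T₀ , sat ← sieve E unique p∤N₀ T₀ x | any? (λ e → prime e ≟ suc x) E
  ... | no none = T , T≡T₀ , λ {e} e∈E p≤ →
    sat e∈E (s≤s⁻¹ (≤∧≢⇒< p≤ λ p≡ → none (lose e∈E p≡)))
  ... | yes some = step (find some)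
    where
    step : (∃ λ e → e ∈ E × prime e ≡ suc x) →
      ∃ λ T → + N₀ ∣ᶻ T -ᴺ T₀ × (∀ {e} → e ∈ E → prime e ≤ suc x → Satisfies e T)
    step (e , e∈E , p≡) = T′ , T′≡T₀ , satisfied
      where
      -- Here x = p - 1. Every smaller prime of the list and its order divide `x !`, so the clauses
      -- settled earlier survive the move, while p divides neither factor of `N`.
      N = N₀ * x !

      divides-N : ∀ {d} → 1 ≤ d → d ≤ x → d ∣ N
      divides-N d≥1 d≤x = ℕ.∣n⇒∣m*n N₀ (n∣m! d≥1 d≤x)

      p∤N : ¬ prime e ∣ N
      p∤N = [ p∤N₀ e∈E , (λ p∣x! → 1+n≰n (subst (_≤ x) p≡ (prime∣!⇒≤ (isPrime e) x p∣x!))) ]′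
          ∘ euclidsLemma N₀ (x !) (isPrime e)

      m≤x : order e ≤ x
      m≤x = s≤s⁻¹ (subst (order e <_) p≡ (order<prime b>0 (primitivity e) (order≥1 e)))

      solution = satisfiable e (divides-N (order≥1 e) m≤x) p∤N T
      s = proj₁ solution
      T′ = T + N * s

      T′-T : ∀ {d} → d ∣ N → + d ∣ᶻ T′ -ᴺ T
      T′-T d∣N = ∣-resp-≡ (sym (+-cancel-ᶻ T (N * s))) (lift (ℕ.∣m⇒∣m*n s d∣N))

      T′≡T₀ : + N₀ ∣ᶻ T′ -ᴺ T₀
      T′≡T₀ = ∣ᶻ-trans (+ T′) (+ T) (+ T₀) (T′-T (ℕ.m∣m*n (x !))) T≡T₀

      satisfied : ∀ {e} → e ∈ E → prime e ≤ suc x → Satisfies e T′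
      satisfied {e′} e′∈E p′≤ with m≤n⇒m<n∨m≡n p′≤
      -- Distinct clauses have distinct primes, so this is the clause just solved.
      ... | inj₂ p′≡ = subst (λ e → Satisfies e T′) (unique e∈E e′∈E (trans p≡ (sym p′≡))) (proj₂ solution)
      ... | inj₁ (s≤s p′≤x) = satisfies-cong e′ T′ T
        (T′-T (divides-N (<⇒≤ (<-≤-trans (modulus>1 e′) m′≤p′)) p′≤x))
        (T′-T (divides-N (order≥1 e′) (≤-trans m′≤p′ p′≤x)))
        (sat e′∈E p′≤x)
        where
        m′≤p′ : order e′ ≤ prime e′
        m′≤p′ = <⇒≤ (order<prime b>0 (primitivity e′) (order≥1 e′))

-- Passing from the lists of congruences and primes to clauses.

unique-map⇒injective : ∀ {A B : Set} {f : A → B} {xs} → Unique (map f xs) →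
  ∀ {x y} → x ∈ xs → y ∈ xs → f x ≡ f y → x ≡ y
unique-map⇒injective (_ ∷ _) (here refl) (here refl) _ = refl
unique-map⇒injective {f = f} (fx∉ ∷ _) (here refl) (there y∈) eq =
  contradiction eq (All.lookup fx∉ (∈-map⁺ f y∈))
unique-map⇒injective {f = f} (fy∉ ∷ _) (there x∈) (here refl) eq =
  contradiction (sym eq) (All.lookup fy∉ (∈-map⁺ f x∈))
unique-map⇒injective (_ ∷ u) (there x∈) (there y∈) eq = unique-map⇒injective u x∈ y∈ eq

∈⇒∣lcmList : ∀ xs {x} → x ∈ xs → x ∣ lcmList xs
∈⇒∣lcmList (x ∷ xs) (here refl) = m∣lcm[m,n] x (lcmList xs)
∈⇒∣lcmList (y ∷ xs) (there x∈)  = ℕ.∣-trans (∈⇒∣lcmList xs x∈) (n∣lcm[m,n] y (lcmList xs))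

clauses : ∀ {b} → ℤ → (cs : List Congruence) → (∀ {m} → m ∈ map modulus cs → 1 < m) →
  ∀ {ps} → Pointwise (IsPrimitivePrimeDivisor b) (map modulus cs) ps → List (Clause b)
clauses ε []       _  []         = []
clauses ε (c ∷ cs) >1 (_∷_ {y = p} P Ps) =
  record { congruence = c ; sign = ε ; prime = p ; modulus>1 = >1 (here refl) ; primitivity = P }
  ∷ clauses ε cs (>1 ∘ there) Ps

map-prime-clauses : ∀ {b} ε cs (>1 : ∀ {m} → m ∈ map modulus cs → 1 < m)
  {ps} (Ps : Pointwise (IsPrimitivePrimeDivisor b) (map modulus cs) ps) →
  map Clause.prime (clauses ε cs >1 Ps) ≡ ps
map-prime-clauses ε []       _  []       = refl
map-prime-clauses ε (c ∷ cs) >1 (P ∷ Ps) = cong (_ ∷_) (map-prime-clauses ε cs (>1 ∘ there) Ps)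

∈-clauses⁺ : ∀ {b} ε cs (>1 : ∀ {m} → m ∈ map modulus cs → 1 < m)
  {ps} (Ps : Pointwise (IsPrimitivePrimeDivisor b) (map modulus cs) ps) →
  ∀ {c} → c ∈ cs → ∃ λ e → e ∈ clauses ε cs >1 Ps × Clause.congruence e ≡ c × Clause.sign e ≡ ε
∈-clauses⁺ ε (c ∷ cs) >1 (P ∷ Ps) (here refl) = _ , here refl , refl , refl
∈-clauses⁺ ε (c ∷ cs) >1 (P ∷ Ps) (there c∈) with e , e∈ , eqs ← ∈-clauses⁺ ε cs (>1 ∘ there) Ps c∈ =
  e , there e∈ , eqs

∈-clauses⁻ : ∀ {b} ε cs (>1 : ∀ {m} → m ∈ map modulus cs → 1 < m)
  {ps} (Ps : Pointwise (IsPrimitivePrimeDivisor b) (map modulus cs) ps) →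
  ∀ {e} → e ∈ clauses ε cs >1 Ps → Clause.order e ∈ map modulus cs
∈-clauses⁻ ε []       >1 []       ()
∈-clauses⁻ ε (c ∷ cs) >1 (P ∷ Ps) (here refl) = here refl
∈-clauses⁻ ε (c ∷ cs) >1 (P ∷ Ps) (there e∈)  = there (∈-clauses⁻ ε cs (>1 ∘ there) Ps e∈)

-- Coprimality and the moduli of the two systems.

-- A common divisor of m^(k+1) and n is coprime to m, so it already divides m^k.
coprime-^ : ∀ {m n} k → Coprime m n → Coprime (m ^ k) n
coprime-^ zero    c (i∣1 , _) = ℕ.∣1⇒≡1 i∣1
coprime-^ {m} (suc k) c {i} (i∣ , i∣n) = coprime-^ k c (coprime-divisor i⊥m i∣ , i∣n)
  where
  i⊥m : Coprime i m
  i⊥m (j∣i , j∣m) = c (j∣m , ℕ.∣-trans j∣i i∣n)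

coprime-*-∣ : ∀ {m n k} → Coprime m n → m ∣ k → n ∣ k → m * n ∣ k
coprime-*-∣ {m} {n} c m∣k (ℕ.divides d refl) =
  ℕ.*-monoˡ-∣ n (coprime-divisor c (subst (m ∣_) (*-comm d n) m∣k))

prime∣prime⇒≡ : ∀ {p r} → Prime p → Prime r → p ∣ r → p ≡ r
prime∣prime⇒≡ p-prime r-prime p∣r with prime⇒irreducible r-prime p∣r
... | inj₁ refl = contradiction p-prime ¬prime[1]
... | inj₂ p≡r  = p≡r

^-∣-^ : ∀ b {m n} → m ≤ n → b ^ m ∣ b ^ n
^-∣-^ b {m} m≤n with d , refl ← m≤n⇒∃[o]m+o≡n m≤n =
  subst (b ^ m ∣_) (sym (^-distribˡ-+-* b m d)) (ℕ.m∣m*n (b ^ d))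

module Moduli (q : ℕ) (q-prime : Prime q) (q≥5 : 5 ≤ q) where

  private
    prime[3] : Prime 3
    prime[3] = from-yes (prime? 3)

    3∤q : ¬ 3 ∣ q
    3∤q 3∣q = <⇒≢ (<-≤-trans (s≤s (s≤s (s≤s (s≤s z≤n)))) q≥5) (prime∣prime⇒≡ prime[3] q-prime 3∣q)

    2∤q : ¬ 2 ∣ q
    2∤q 2∣q = <⇒≢ (<-≤-trans (s≤s (s≤s (s≤s z≤n))) q≥5) (prime∣prime⇒≡ prime[2] q-prime 2∣q)

    3∤2^ : ∀ j → ¬ 3 ∣ 2 ^ j
    3∤2^ j = from-no (3 ℕ.∣? 2) ∘ prime∣^⇒prime∣ prime[3] 2 j

    2^>0 : ∀ j → 1 ≤ 2 ^ j
    2^>0 j = m^n>0 2 j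

    1<q : 1 < q
    1<q = <-≤-trans (s≤s (s≤s z≤n)) q≥5

    1<* : ∀ {m n} → 1 ≤ m → 1 < n → 1 < m * n
    1<* {m} {n} m≥1 n>1 = <-≤-trans n>1 (m≤n*m n m {{>-nonZero m≥1}})

  -- A common multiple of all moduli of both systems that still divides M. Through it, a class
  -- modulo M determines t modulo every order.
  period : ℕ
  period = 2 ^ q * 3 ^ q * q

  -- Divisibility by 3 is what separates these moduli from those in `moduli₂-spec`.
  moduli₁-spec : ∀ {m} → m ∈ moduli₁ q → 1 < m × ¬ (3 ∣ m) × (m ∣ period)
  moduli₁-spec m∈ with ∈-++⁻ (map (λ j → 2 ^ j) [1⋯ q ]) m∈
  ... | inj₁ m∈2^ with _ , j∈ , refl ← ∈-map⁻ (λ j → 2 ^ j) m∈2^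
    with j , j∈′ , refl ← ∈-map⁻ suc j∈ =
    1<2^ , 3∤2^ (suc j) , ℕ.∣m⇒∣m*n q (ℕ.∣m⇒∣m*n (3 ^ q) (^-∣-^ 2 (∈-upTo⁻ j∈′)))
    where
    1<2^ : 1 < 2 ^ suc j
    1<2^ = subst (1 <_) (*-comm (2 ^ j) 2) (1<* (2^>0 j) (s≤s (s≤s z≤n)))
  moduli₁-spec m∈ | inj₂ m∈2^q with j , j∈ , refl ← ∈-map⁻ (λ j → 2 ^ j * q) {xs = [0⋯ q ]} m∈2^q =
    1<* (2^>0 j) 1<q
    , [ 3∤2^ j , 3∤q ]′ ∘ euclidsLemma (2 ^ j) q prime[3]
    , ℕ.*-monoˡ-∣ q (ℕ.∣m⇒∣m*n (3 ^ q) (^-∣-^ 2 (s≤s⁻¹ (∈-upTo⁻ j∈))))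

  moduli₂-spec : ∀ {m} → m ∈ moduli₂ q → 1 < m × (3 ∣ m) × (m ∣ period)
  moduli₂-spec m∈
    with x , y , x∈ , y∈ , refl ← ∈-cartesianProductWith⁻ _*_
      (cartesianProductWith (λ j i → 2 ^ j * 3 ^ i) [0⋯ q ] [1⋯ q ]) (map (λ j′ → q ^ j′) [0⋯ 1 ]) m∈
    with j , _ , j∈ , i∈ , refl ← ∈-cartesianProductWith⁻ (λ j i → 2 ^ j * 3 ^ i) [0⋯ q ] [1⋯ q ] x∈
    with i , i∈′ , refl ← ∈-map⁻ suc i∈
    with j′ , j′∈ , refl ← ∈-map⁻ (λ j′ → q ^ j′) {xs = [0⋯ 1 ]} y∈ =
    <-≤-trans (s≤s (s≤s z≤n)) (ℕ.∣⇒≤ {{m≢0}} 3∣m) , 3∣m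
    , ℕ.*-pres-∣ (ℕ.*-pres-∣ (^-∣-^ 2 (s≤s⁻¹ (∈-upTo⁻ j∈))) (^-∣-^ 3 (∈-upTo⁻ i∈′)))
        (subst (q ^ j′ ∣_) (*-identityʳ q) (^-∣-^ q (s≤s⁻¹ (∈-upTo⁻ j′∈))))
    where
    3∣m : 3 ∣ 2 ^ j * 3 ^ suc i * q ^ j′
    3∣m = ℕ.∣m⇒∣m*n (q ^ j′) (ℕ.∣n⇒∣m*n (2 ^ j) (ℕ.m∣m*n (3 ^ i)))
    m≢0 : NonZero (2 ^ j * 3 ^ suc i * q ^ j′)
    m≢0 = m*n≢0 _ _ {{m*n≢0 _ _ {{m^n≢0 2 j}} {{m^n≢0 3 (suc i)}}}} {{m^n≢0 q j′ {{>-nonZero (<⇒≤ 1<q)}}}}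

  -- The three factors are pairwise coprime, because q ≥ 5 is a prime different from 2 and 3.
  period∣ : ∀ {M} → 2 ^ q ∣ M → 3 ^ q ∣ M → q ∣ M → period ∣ M
  period∣ 2^∣ 3^∣ q∣ = coprime-*-∣ 6^⊥q (coprime-*-∣ 2^⊥3^ 2^∣ 3^∣) q∣
    where
    2⊥3 : Coprime 2 3
    2⊥3 = prime∤⇒coprime prime[2] (from-no (2 ℕ.∣? 3))
    2^⊥3^ : Coprime (2 ^ q) (3 ^ q)
    2^⊥3^ = Coprime.sym (coprime-^ q (Coprime.sym (coprime-^ q 2⊥3)))
    6^⊥q : Coprime (2 ^ q * 3 ^ q) q
    6^⊥q {i} (i∣ , i∣q) = coprime-^ q (prime∤⇒coprime prime[3] 3∤q)
      (coprime-divisor {i} {2 ^ q} i⊥2^ i∣ , i∣q)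
      where
      i⊥2^ : Coprime i (2 ^ q)
      i⊥2^ (j∣i , j∣2^) = coprime-^ q (prime∤⇒coprime prime[2] 2∤q) (j∣2^ , ℕ.∣-trans j∣i i∣q)

-- Sufficient conditions for a Brier number.

-- Here y is an inverse of x modulo n: a common divisor of x and n divides both x y and x y - 1.
gcd≡1 : ∀ {n} x y → + n ∣ᶻ x ℤ.* y ℤ.- 1ℤ → ℤ.gcd x (+ n) ≡ 1ℤ
gcd≡1 {n} x y n∣ = cong +_ (ℕ.∣1⇒≡1 (lower g∣1))
  where
  g = gcd ∣ x ∣ n
  cancel : ∀ z → z ℤ.- (z ℤ.- 1ℤ) ≡ 1ℤ
  cancel = solve-∀
  g∣1 : + g ∣ᶻ 1ℤ
  g∣1 = ∣-resp-≡ (cancel (x ℤ.* y)) (ℤ.∣m∣n⇒∣m-n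
    (ℤ.∣m⇒∣m*n y (ℤ.∣ᵤ⇒∣ {+ g} {x} (gcd[m,n]∣m ∣ x ∣ n)))
    (ℤ.∣-trans (lift (gcd[m,n]∣n ∣ x ∣ n)) n∣))

composite-if-∣ : ∀ {p n} → Prime p → p < n → p ∣ n → Composite n
composite-if-∣ {p} p-prime p<n = composite-≢ p {{prime⇒nonTrivial p-prime}} {{>-nonZero (≤-<-trans z≤n p<n)}} (<⇒≢ p<n)

t*b^t-strictMono : ∀ {b} → 2 ≤ b → ∀ {t t′} → t < t′ → t * b ^ t < t′ * b ^ t′
t*b^t-strictMono {b} b≥2 {t} {t′} t<t′ = <-≤-trans
  (*-monoˡ-< (b ^ t) {{m^n≢0 b t}} t<t′)
  (*-monoʳ-≤ t′ (^-monoʳ-≤ b (<⇒≤ t<t′)))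
  where
  instance
    b≢0 : NonZero b
    b≢0 = >-nonZero (<⇒≤ b≥2)

t*b^t-injective : ∀ {b} → 2 ≤ b → ∀ t t′ → t * b ^ t ≡ t′ * b ^ t′ → t ≡ t′
t*b^t-injective b≥2 t t′ eq with <-cmp t t′
... | tri< t<t′ _ _ = contradiction eq (<⇒≢ (t*b^t-strictMono b≥2 t<t′))
... | tri≈ _ t≡t′ _ = t≡t′
... | tri> _ _ t>t′ = contradiction (sym eq) (<⇒≢ (t*b^t-strictMono b≥2 t>t′))

-- The first bound gives x ≥ m - 1, and the distance condition removes m - 1, m and m + 1. Hence
-- even x - 1 exceeds m. This will be applied to x = k b and the largest prime m.
far-below : ∀ {m} x → + m ℤ.≤ x ℤ.+ 1ℤ → ¬ ∣ x ℤ.- + m ∣ ≤ 1 → ∃ λ n → x ≡ + n × 2 + m ≤ n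
far-below {m} x m≤x+1 far with x ℤ.- + m in eq
... | + d = d + m , trans (sym (restore x (+ m))) (trans (cong (ℤ._+ + m) eq) (sym (ℤ.pos-+ d m)))
          , +-monoˡ-≤ m (≰⇒> far)
  where
  restore : ∀ x m → x ℤ.- m ℤ.+ m ≡ x
  restore = solve-∀
... | -[1+ zero ] = contradiction ≤-refl far
... | -[1+ suc d ] = contradiction (subst (0ℤ ℤ.≤_) eq′ (ℤ.i≤j⇒0≤j-i m≤x+1)) λ ()
  where
  shuffle : ∀ x m → (x ℤ.+ 1ℤ) ℤ.- m ≡ (x ℤ.- m) ℤ.+ 1ℤ
  shuffle = solve-∀
  eq′ : (x ℤ.+ 1ℤ) ℤ.- + m ≡ -[1+ d ]
  eq′ = trans (shuffle x (+ m)) (cong (ℤ._+ 1ℤ) eq)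

-- δ is n if 2^q ∤ n, and n / 2 otherwise.
nonzero-nilpotent : ∀ n q → NonZero n → 2 ≤ q → ∃ λ δ → n ∣ δ * δ × ¬ ((2 ^ q ∣ δ) × (n ∣ δ))
nonzero-nilpotent n q n≢0 q≥2 with 2 ^ q ℕ.∣? n
... | no 2^q∤n = n , ℕ.m∣m*n n , 2^q∤n ∘ proj₁
-- As q ≥ 2, n is divisible by 4 here, so (n/2)² = (n/4) n, whereas n/2 is not a multiple of n.
nonzero-nilpotent n (suc (suc j)) n≢0 (s≤s (s≤s _)) | yes (ℕ.divides c n≡c2^q) =
  h , ℕ.divides (c * 2 ^ j) square , λ (_ , n∣h) → <⇒≱ h<n (ℕ.∣⇒≤ {{h≢0}} n∣h)
  where
  open import Algebra.Properties.CommutativeSemigroup *-commutativeSemigroup using (x∙yz≈y∙xz; x∙yz≈xz∙y)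
  h = c * 2 ^ suc j
  n≡2h : n ≡ 2 * h
  n≡2h = trans n≡c2^q (x∙yz≈y∙xz c 2 (2 ^ suc j))
  h≢0 : NonZero h
  h≢0 = m*n≢0⇒n≢0 2 {{subst NonZero n≡2h n≢0}}
  h<n : h < n
  h<n = subst (h <_) (sym n≡2h) (m<m+n h (subst (0 <_) (sym (+-identityʳ h)) (>-nonZero⁻¹ h {{h≢0}})))
  square : h * h ≡ c * 2 ^ j * n
  square = begin
    h * h                ≡⟨ cong (_* h) (x∙yz≈xz∙y c 2 (2 ^ j)) ⟩
    c * 2 ^ j * 2 * h    ≡⟨ *-assoc (c * 2 ^ j) 2 h ⟩
    c * 2 ^ j * (2 * h)  ≡⟨ cong (c * 2 ^ j *_) n≡2h ⟨
    c * 2 ^ j * n        ∎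
    where open ≡-Reasoning

-- Since x² ≡ 0 modulo b - 1, the product (x + 1)(1 - x) is 1 there, so both x + 1 and x - 1 are
-- invertible. For n ≥ 1, x b^n - 1 ≥ x b - 1 > m, so the prime divisors supplied, being at most m,
-- are proper.
brier-criterion : ∀ {b m} → 1 ≤ b → ∀ x →
  (∀ n → ∃ λ p → Prime p × p ≤ m × + p ∣ᶻ x ℤ.* + (b ^ n) ℤ.+ 1ℤ) →
  (∀ n → ∃ λ p → Prime p × p ≤ m × + p ∣ᶻ x ℤ.* + (b ^ n) ℤ.- 1ℤ) →
  + (b ∸ 1) ∣ᶻ x ℤ.* x → ∀ {n} → x ℤ.* + b ≡ + n → 2 + m ≤ n → IsBrier b x
brier-criterion {b} {m} b≥1 x covered₁ covered₂ b-1∣x² {N} xb≡N m+2≤N = positive-case x refl x>0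
  where
  instance
    b≢0 : NonZero b
    b≢0 = >-nonZero b≥1

  x>0 : 0ℤ ℤ.< x
  x>0 = ℤ.*-cancelʳ-<-nonNeg {0ℤ} {x} (+ b) (subst (0ℤ ℤ.<_) (sym xb≡N) (+<+ (≤-trans (s≤s z≤n) m+2≤N)))

  coprime₊ : ℤ.gcd (x ℤ.+ 1ℤ) (+ b ℤ.- 1ℤ) ≡ 1ℤ
  coprime₊ = subst (λ z → ℤ.gcd (x ℤ.+ 1ℤ) z ≡ 1ℤ) (sym (∸1-exact b≥1))
    (gcd≡1 (x ℤ.+ 1ℤ) (ℤ.- (x ℤ.- 1ℤ)) (∣-resp-≡ (expand x) (ℤ.∣m⇒∣-m b-1∣x²)))
    where
    expand : ∀ x → ℤ.- (x ℤ.* x) ≡ (x ℤ.+ 1ℤ) ℤ.* (ℤ.- (x ℤ.- 1ℤ)) ℤ.- 1ℤ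
    expand = solve-∀

  coprime₋ : ℤ.gcd (x ℤ.- 1ℤ) (+ b ℤ.- 1ℤ) ≡ 1ℤ
  coprime₋ = subst (λ z → ℤ.gcd (x ℤ.- 1ℤ) z ≡ 1ℤ) (sym (∸1-exact b≥1))
    (gcd≡1 (x ℤ.- 1ℤ) (ℤ.- (x ℤ.+ 1ℤ)) (∣-resp-≡ (expand x) (ℤ.∣m⇒∣-m b-1∣x²)))
    where
    expand : ∀ x → ℤ.- (x ℤ.* x) ≡ (x ℤ.- 1ℤ) ℤ.* (ℤ.- (x ℤ.+ 1ℤ)) ℤ.- 1ℤ
    expand = solve-∀

  positive-case : ∀ y → x ≡ y → 0ℤ ℤ.< y → IsBrier b x
  positive-case (+ κ) x≡κ (+<+ κ>0) =
    record { positive = x>0 ; coprime = coprime₊ ; composite = composite₊ } ,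
    record { positive = x>0 ; coprime = coprime₋ ; composite = composite₋ }
    where
    xb^≡ : ∀ n → x ℤ.* + (b ^ n) ≡ + (κ * b ^ n)
    xb^≡ n = trans (cong (ℤ._* + (b ^ n)) x≡κ) (sym (ℤ.pos-* κ (b ^ n)))

    m+2≤κb^ : ∀ n → 1 ≤ n → 2 + m ≤ κ * b ^ n
    m+2≤κb^ (suc n) _ = begin
      2 + m          ≤⟨ m+2≤N ⟩
      N              ≡⟨ ℤ.+-injective (trans (ℤ.pos-* κ b) (trans (cong (ℤ._* + b) (sym x≡κ)) xb≡N)) ⟨
      κ * b          ≤⟨ *-monoʳ-≤ κ (m≤m*n b (b ^ n) {{m^n≢0 b n}}) ⟩
      κ * b ^ suc n  ∎
      where open ≤-Reasoning

    composite₊ : ∀ n → 1 ≤ n → Composite ∣ x ℤ.* + (b ^ n) ℤ.+ 1ℤ ∣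
    composite₊ n n≥1 with p , p-prime , p≤ , p∣ ← covered₁ n =
      subst (λ z → Composite ∣ z ℤ.+ 1ℤ ∣) (sym (xb^≡ n)) (composite-if-∣ p-prime
        (≤-<-trans p≤ (<-≤-trans (≤-trans (n≤1+n (suc m)) (m+2≤κb^ n n≥1)) (m≤m+n (κ * b ^ n) 1)))
        (lower (∣-resp-≡ (cong (ℤ._+ 1ℤ) (xb^≡ n)) p∣)))

    composite₋ : ∀ n → 1 ≤ n → Composite ∣ x ℤ.* + (b ^ n) ℤ.- 1ℤ ∣
    composite₋ n n≥1 with p , p-prime , p≤ , p∣ ← covered₂ n =
      subst (λ z → Composite ∣ z ℤ.- 1ℤ ∣) (sym (xb^≡ n))
        (composite₋′ p-prime p≤ (m+2≤κb^ n n≥1) (∣-resp-≡ (cong (ℤ._- 1ℤ) (xb^≡ n)) p∣))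
      where
      composite₋′ : ∀ {p y} → Prime p → p ≤ m → 2 + m ≤ y → + p ∣ᶻ y -ᴺ 1 → Composite ∣ y -ᴺ 1 ∣
      composite₋′ p-prime p≤m (s≤s m<y) p∣ = composite-if-∣ p-prime (≤-<-trans p≤m m<y) (lower p∣)

-- The two covering systems combined, and the choice of T.

module Brier
  (b : ℕ) (b≥3 : 3 ≤ b) (α : ℤ) (q : ℕ) (q-prime : Prime q) (q≥5 : 5 ≤ q)
  (C₁ C₂ : CoveringSystem)
  (C₁↭ : moduli C₁ ↭ moduli₁ q) (C₂↭ : moduli C₂ ↭ moduli₂ q)
  (P₁ : Primitive b C₁) (P₂ : Primitive b C₂)
  where

  open Moduli q q-prime q≥5

  b≥1 : 1 ≤ b
  b≥1 = ≤-trans (s≤s z≤n) b≥3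

  b≥2 : 2 ≤ b
  b≥2 = ≤-trans (s≤s (s≤s z≤n)) b≥3

  open Sieve b b≥1 α
  open Clause

  𝒫 : List ℕ
  𝒫 = primes P₁ ++ primes P₂

  M : ℕ
  M = lcmList ((2 ^ q ∷ 3 ^ q ∷ b ∸ 1 ∷ q ∷ []) ++ 𝒫)

  P* : ℕ
  P* = max 0 𝒫

  Bad : ℕ → Set
  Bad t = ∣ k t ℤ.* + b ℤ.- + P* ∣ ≤ 1

  -- Two bad values of k b lie within 2 of each other and differ by a multiple of b ≥ 3, so they
  -- coincide. Injectivity of t b^t finishes the argument.
  bad-unique : ∀ {t t′} → Bad t → Bad t′ → t ≡ t′
  bad-unique {t} {t′} bad bad′ = t*b^t-injective b≥2 t t′
    (ℤ.+-injective (ℤ.i-j≡0⇒i≡j (+ (t * b ^ t)) (+ (t′ * b ^ t′)) (ℤ.∣i∣≡0⇒i≡0 {D} (n<1⇒n≡0 (*-cancelʳ-< b ∣ D ∣ 1 ∣D∣b<b)))))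
    where
    D : ℤ
    D = + (t * b ^ t) ℤ.- + (t′ * b ^ t′)
    shuffle : ∀ x y a b m → (x ℤ.- y) ℤ.* b ≡ ((x ℤ.+ a) ℤ.* b ℤ.- m) ℤ.- ((y ℤ.+ a) ℤ.* b ℤ.- m)
    shuffle = solve-∀
    open ≤-Reasoning
    ∣D∣b<b : ∣ D ∣ * b < 1 * b
    ∣D∣b<b = begin-strict
      ∣ D ∣ * b                                                    ≡⟨ ℤ.abs-* D (+ b) ⟨
      ∣ D ℤ.* + b ∣                                                ≡⟨ cong ∣_∣ (shuffle (+ (t * b ^ t)) (+ (t′ * b ^ t′)) α (+ b) (+ P*)) ⟩
      ∣ (k t ℤ.* + b ℤ.- + P*) ℤ.- (k t′ ℤ.* + b ℤ.- + P*) ∣        ≤⟨ ℤ.∣i-j∣≤∣i∣+∣j∣ (k t ℤ.* + b ℤ.- + P*) (k t′ ℤ.* + b ℤ.- + P*) ⟩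
      ∣ k t ℤ.* + b ℤ.- + P* ∣ + ∣ k t′ ℤ.* + b ℤ.- + P* ∣          ≤⟨ +-mono-≤ bad bad′ ⟩
      2                                                            <⟨ b≥3 ⟩
      b                                                            ≡⟨ *-identityˡ b ⟨
      1 * b                                                        ∎

  bad-bound : ℕ
  bad-bound = 2 + ∣ + P* ℤ.- α ℤ.* + b ∣

  -- For bad t, the product t b^t b is within 1 of `P*` - α b. The bound turns the search for a bad
  -- t in a given class into a finite, decidable one.
  bad-bounded : ∀ {t} → Bad t → t < bad-bound
  bad-bounded {t} bad = s≤s (begin
    t                                                       ≤⟨ m≤m*n t (b ^ t) {{m^n≢0 b t}} ⟩
    t * b ^ t                                               ≤⟨ m≤m*n (t * b ^ t) b ⟩
    t * b ^ t * b                                           ≡⟨ cong ∣_∣ (ℤ.pos-* (t * b ^ t) b) ⟩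
    ∣ + (t * b ^ t) ℤ.* + b ∣                               ≡⟨ cong ∣_∣ (shuffle (+ (t * b ^ t)) α (+ b) (+ P*)) ⟩
    ∣ (k t ℤ.* + b ℤ.- + P*) ℤ.+ (+ P* ℤ.- α ℤ.* + b) ∣      ≤⟨ ℤ.∣i+j∣≤∣i∣+∣j∣ (k t ℤ.* + b ℤ.- + P*) (+ P* ℤ.- α ℤ.* + b) ⟩
    ∣ k t ℤ.* + b ℤ.- + P* ∣ + ∣ + P* ℤ.- α ℤ.* + b ∣        ≤⟨ +-monoˡ-≤ _ bad ⟩
    1 + ∣ + P* ℤ.- α ℤ.* + b ∣                              ∎)
    where
    open ≤-Reasoning
    instance
      b≢0 : NonZero b
      b≢0 = >-nonZero b≥1
    shuffle : ∀ x a b m → x ℤ.* b ≡ ((x ℤ.+ a) ℤ.* b ℤ.- m) ℤ.+ (m ℤ.- a ℤ.* b)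
    shuffle = solve-∀

  C₁>1 : ∀ {m} → m ∈ moduli C₁ → 1 < m
  C₁>1 = proj₁ ∘ moduli₁-spec ∘ ∈-resp-↭ C₁↭

  C₂>1 : ∀ {m} → m ∈ moduli C₂ → 1 < m
  C₂>1 = proj₁ ∘ moduli₂-spec ∘ ∈-resp-↭ C₂↭

  E₁ E₂ E : List (Clause b)
  E₁ = clauses 1ℤ (congruences C₁) C₁>1 (primitivePrime P₁)
  E₂ = clauses ℤ.-1ℤ (congruences C₂) C₂>1 (primitivePrime P₂)
  E  = E₁ ++ E₂

  order∈₁ : ∀ {e} → e ∈ E₁ → order e ∈ moduli₁ q
  order∈₁ = ∈-resp-↭ C₁↭ ∘ ∈-clauses⁻ 1ℤ (congruences C₁) C₁>1 (primitivePrime P₁)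

  order∈₂ : ∀ {e} → e ∈ E₂ → order e ∈ moduli₂ q
  order∈₂ = ∈-resp-↭ C₂↭ ∘ ∈-clauses⁻ ℤ.-1ℤ (congruences C₂) C₂>1 (primitivePrime P₂)

  primes-E₁ : map prime E₁ ≡ primes P₁
  primes-E₁ = map-prime-clauses 1ℤ (congruences C₁) C₁>1 (primitivePrime P₁)

  primes-E₂ : map prime E₂ ≡ primes P₂
  primes-E₂ = map-prime-clauses ℤ.-1ℤ (congruences C₂) C₂>1 (primitivePrime P₂)

  primes-E : map prime E ≡ 𝒫
  primes-E = trans (map-++ prime E₁ E₂) (cong₂ _++_ primes-E₁ primes-E₂)

  -- A common prime would give b a single order that is a modulus of both systems, but 3 divides
  -- every modulus of the second and none of the first.
  disjoint : Disjoint (primes P₁) (primes P₂)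
  disjoint {p} (p∈₁ , p∈₂)
    with e₁ , e₁∈ , refl ← ∈-map⁻ prime {xs = E₁} (subst (p ∈_) (sym primes-E₁) p∈₁)
    with e₂ , e₂∈ , p≡ ← ∈-map⁻ prime {xs = E₂} (subst (p ∈_) (sym primes-E₂) p∈₂)
    = proj₁ (proj₂ (moduli₁-spec (order∈₁ e₁∈)))
        (subst (3 ∣_) (sym orders≡) (proj₁ (proj₂ (moduli₂-spec (order∈₂ e₂∈)))))
    where
    orders≡ : order e₁ ≡ order e₂
    orders≡ = order-unique (order≥1 e₁) (order≥1 e₂) (primitivity e₁)
      (subst (IsPrimitivePrimeDivisor b (order e₂)) (sym p≡) (primitivity e₂))

  E-unique : ∀ {e e′} → e ∈ E → e′ ∈ E → prime e ≡ prime e′ → e ≡ e′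
  E-unique = unique-map⇒injective
    (subst Unique (sym primes-E) (Unique.++⁺ (primesDistinct P₁) (primesDistinct P₂) disjoint))

  prime∈𝒫 : ∀ {e} → e ∈ E → prime e ∈ 𝒫
  prime∈𝒫 {e} e∈ = subst (prime e ∈_) primes-E (∈-map⁺ prime e∈)

  prime≤P* : ∀ {e} → e ∈ E → prime e ≤ P*
  prime≤P* e∈ = All.lookup (xs≤max 0 𝒫) (prime∈𝒫 e∈)

  -- The residue of t modulo this number is prescribed before the sieve: b - 1 governs the gcd
  -- conditions, and 2^q helps to tell two classes apart. The product need not divide M, but each
  -- factor does, so classes modulo M are compared modulo the factors separately.
  N₀ : ℕ
  N₀ = 2 ^ q * (b ∸ 1)

  N₀≢0 : NonZero N₀
  N₀≢0 = m*n≢0 _ _ {{m^n≢0 2 q}} {{>-nonZero (∸-monoˡ-≤ 1 b≥2)}}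

  -- A prime of the list exceeds the order of b, which is at least 2, so it does not divide 2.
  -- Minimality of the order at exponent 1 rules out b - 1.
  prime∤N₀ : ∀ {e} → e ∈ E → ¬ prime e ∣ N₀
  prime∤N₀ {e} _ = [ p∤2 ∘ prime∣^⇒prime∣ (isPrime e) 2 q , p∤b-1 ]′ ∘ euclidsLemma (2 ^ q) (b ∸ 1) (isPrime e)
    where
    p∤2 : ¬ prime e ∣ 2
    p∤2 p∣2 = <⇒≱ (<-≤-trans (s≤s (modulus>1 e)) (order<prime b≥1 (primitivity e) (order≥1 e))) (ℕ.∣⇒≤ p∣2)
    p∤b-1 : ¬ prime e ∣ b ∸ 1
    p∤b-1 = IsPrimitivePrimeDivisor.minimal (primitivity e) 1 ≤-refl (modulus>1 e)
          ∘ subst (λ x → prime e ∣ x ∸ 1) (sym (*-identityʳ b))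

  Ms : List ℕ
  Ms = (2 ^ q ∷ 3 ^ q ∷ b ∸ 1 ∷ q ∷ []) ++ 𝒫

  2^q∣M : 2 ^ q ∣ M
  2^q∣M = ∈⇒∣lcmList Ms (here refl)

  b-1∣M : b ∸ 1 ∣ M
  b-1∣M = ∈⇒∣lcmList Ms (there (there (here refl)))

  period∣M : period ∣ M
  period∣M = period∣ 2^q∣M
    (∈⇒∣lcmList Ms (there (here refl)))
    (∈⇒∣lcmList Ms (there (there (there (here refl)))))

  prime∣M : ∀ {e} → e ∈ E → prime e ∣ M
  prime∣M e∈ = ∈⇒∣lcmList Ms (∈-++⁺ʳ (2 ^ q ∷ 3 ^ q ∷ b ∸ 1 ∷ q ∷ []) (prime∈𝒫 e∈))

  order∣M : ∀ {e} → e ∈ E → order e ∣ M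
  order∣M e∈ = ℕ.∣-trans
    ([ proj₂ ∘ proj₂ ∘ moduli₁-spec ∘ order∈₁ , proj₂ ∘ proj₂ ∘ moduli₂-spec ∘ order∈₂ ]′ (∈-++⁻ E₁ e∈))
    period∣M

  Solves : ℕ → Set
  Solves t = ∀ {e} → e ∈ E → Satisfies e t

  covered₁ : ∀ t → Solves t → ∀ n → ∃ λ p → Prime p × p ≤ P* × + p ∣ᶻ k t ℤ.* + (b ^ n) ℤ.+ 1ℤ
  covered₁ t sat n with c , c∈ , n≡ ← find (covers C₁ (+ n))
    with e , e∈ , refl , ε≡ ← ∈-clauses⁺ 1ℤ (congruences C₁) C₁>1 (primitivePrime P₁) c∈ =
    prime e , isPrime e , prime≤P* e∈E
    , subst (λ ε → + prime e ∣ᶻ k t ℤ.* + (b ^ n) ℤ.+ ε) ε≡ (sat e∈E n n≡)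
    where
    e∈E : e ∈ E
    e∈E = ∈-++⁺ˡ e∈

  covered₂ : ∀ t → Solves t → ∀ n → ∃ λ p → Prime p × p ≤ P* × + p ∣ᶻ k t ℤ.* + (b ^ n) ℤ.- 1ℤ
  covered₂ t sat n with c , c∈ , n≡ ← find (covers C₂ (+ n))
    with e , e∈ , refl , ε≡ ← ∈-clauses⁺ ℤ.-1ℤ (congruences C₂) C₂>1 (primitivePrime P₂) c∈ =
    prime e , isPrime e , prime≤P* e∈E
    , subst (λ ε → + prime e ∣ᶻ k t ℤ.* + (b ^ n) ℤ.+ ε) ε≡ (sat e∈E n n≡)
    where
    e∈E : e ∈ E
    e∈E = ∈-++⁺ʳ E₁ e∈

  brier : ∀ t → Solves t → + (b ∸ 1) ∣ᶻ k t ℤ.* k t →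
    + P* ℤ.≤ k t ℤ.* + b ℤ.+ 1ℤ → ¬ Bad t → IsBrier b (k t)
  brier t sat b-1∣k² large good with n , kb≡n , P*+2≤n ← far-below (k t ℤ.* + b) large good =
    brier-criterion b≥1 (k t) (covered₁ t sat) (covered₂ t sat) b-1∣k² kb≡n P*+2≤n

  -- As b ≡ 1 (mod b - 1), the residue δ - α for t makes k ≡ δ (mod b - 1); when
  -- b - 1 ∣ δ², it follows that k² ≡ 0 and both gcd conditions hold.
  solution : ∀ δ → b ∸ 1 ∣ δ * δ →
    ∃ λ T → + N₀ ∣ᶻ + T ℤ.- (+ δ ℤ.- α) ×
      (∀ t → + t ≡ + T [mod M ] → + P* ℤ.≤ k t ℤ.* + b ℤ.+ 1ℤ → ¬ Bad t → IsBrier b (k t))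
  solution δ b-1∣δ²
    with T₀ , T₀≡ ← natural-representative N₀ {{N₀≢0}} (+ δ ℤ.- α)
    with T , T≡T₀ , sat ← sieve E E-unique prime∤N₀ T₀ P*
    = T , T≡δ-α , λ t t≡T → brier t (solves t (ℤ.∣ᵤ⇒∣ t≡T)) (b-1∣k² t (ℤ.∣ᵤ⇒∣ t≡T))
    where
    T≡δ-α : + N₀ ∣ᶻ + T ℤ.- (+ δ ℤ.- α)
    T≡δ-α = ∣ᶻ-trans (+ T) (+ T₀) (+ δ ℤ.- α) T≡T₀ T₀≡

    solves : ∀ t → + M ∣ᶻ t -ᴺ T → Solves t
    solves t t≡T {e} e∈ = satisfies-cong e t T
      (ℤ.∣-trans (lift (prime∣M e∈)) t≡T) (ℤ.∣-trans (lift (order∣M e∈)) t≡T) (sat e∈ (prime≤P* e∈))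

    b-1∣k² : ∀ t → + M ∣ᶻ t -ᴺ T → + (b ∸ 1) ∣ᶻ k t ℤ.* k t
    b-1∣k² t t≡T = ∣-resp-≡ eq (ℤ.∣m∣n⇒∣m+n (ℤ.∣m⇒∣m*n (k t ℤ.+ + δ) b-1∣k-δ) (lift b-1∣δ²))
      where
      t≡δ-α : + (b ∸ 1) ∣ᶻ + t ℤ.- (+ δ ℤ.- α)
      t≡δ-α = ∣ᶻ-trans (+ t) (+ T) (+ δ ℤ.- α)
        (ℤ.∣-trans (lift b-1∣M) t≡T) (ℤ.∣-trans (lift (ℕ.n∣m*n (2 ^ q))) T≡δ-α)
      b^t≡1 : + (b ∸ 1) ∣ᶻ b ^ t -ᴺ 1
      b^t≡1 = ^-≡1 (ℤ.∣-reflexive (sym (∸1-exact b≥1))) t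
      regroup : ∀ t x a d → t ℤ.* (x ℤ.- 1ℤ) ℤ.+ (t ℤ.- (d ℤ.- a)) ≡ (t ℤ.* x ℤ.+ a) ℤ.- d
      regroup = solve-∀
      b-1∣k-δ : + (b ∸ 1) ∣ᶻ k t ℤ.- + δ
      b-1∣k-δ = ∣-resp-≡
        (trans (regroup (+ t) (+ (b ^ t)) α (+ δ)) (cong (λ z → (z ℤ.+ α) ℤ.- + δ) (sym (ℤ.pos-* t (b ^ t)))))
        (ℤ.∣m∣n⇒∣m+n (ℤ.∣n⇒∣m*n (+ t) b^t≡1) t≡δ-α)
      difference-of-squares : ∀ x d → (x ℤ.- d) ℤ.* (x ℤ.+ d) ℤ.+ d ℤ.* d ≡ x ℤ.* x
      difference-of-squares = solve-∀
      eq : (k t ℤ.- + δ) ℤ.* (k t ℤ.+ + δ) ℤ.+ + (δ * δ) ≡ k t ℤ.* k t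
      eq = trans (cong (λ z → (k t ℤ.- + δ) ℤ.* (k t ℤ.+ + δ) ℤ.+ z) (ℤ.pos-* δ δ)) (difference-of-squares (k t) (+ δ))

  -- Two admissible residues of t modulo N₀; at most one of the resulting classes modulo M
  -- contains a bad t.
  brier-class : ∃ λ T → ∀ t → + t ≡ + T [mod M ] → + P* ℤ.≤ k t ℤ.* + b ℤ.+ 1ℤ → IsBrier b (k t)
  brier-class = choose (anyUpTo? (λ t → (M ℕ.∣? ∣ t -ᴺ T₁ ∣) ×-dec (∣ k t ℤ.* + b ℤ.- + P* ∣ ≤? 1)) bad-bound)
    where
    shift = nonzero-nilpotent (b ∸ 1) q (>-nonZero (∸-monoˡ-≤ 1 b≥2)) (≤-trans (s≤s (s≤s z≤n)) q≥5)
    δ = proj₁ shift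
    solution₁ = solution 0 ((b ∸ 1) ℕ.∣0)
    solution₂ = solution δ (proj₁ (proj₂ shift))
    T₁ = proj₁ solution₁
    T₂ = proj₁ solution₂

    -- If t lay in both classes, `T₁` and `T₂` would agree modulo d, where they are - α and δ - α.
    -- Taking d to be 2^q and then b - 1 contradicts the choice of `δ`.
    divides-δ : ∀ {d t} → d ∣ M → d ∣ N₀ → + M ∣ᶻ t -ᴺ T₁ → + M ∣ᶻ t -ᴺ T₂ → d ∣ δ
    divides-δ {d} {t} d∣M d∣N₀ t≡T₁ t≡T₂ = lower (∣-resp-≡ (cancel (+ t) (+ T₂) (+ T₁) α (+ δ))
      (ℤ.∣m∣n⇒∣m+n
        (ℤ.∣m∣n⇒∣m-n (ℤ.∣-trans (lift d∣M) (ℤ.∣m∣n⇒∣m-n t≡T₁ t≡T₂))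
          (ℤ.∣-trans (lift d∣N₀) (proj₁ (proj₂ solution₂))))
        (ℤ.∣-trans (lift d∣N₀) (proj₁ (proj₂ solution₁)))))
      where
      cancel : ∀ t x y a d →
        (((t ℤ.- y) ℤ.- (t ℤ.- x)) ℤ.- (x ℤ.- (d ℤ.- a))) ℤ.+ (y ℤ.- (0ℤ ℤ.- a)) ≡ d
      cancel = solve-∀

    incongruent : ∀ {t} → + M ∣ᶻ t -ᴺ T₁ → ¬ + M ∣ᶻ t -ᴺ T₂
    incongruent t≡T₁ t≡T₂ = proj₂ (proj₂ shift)
      ( divides-δ 2^q∣M (ℕ.m∣m*n (b ∸ 1)) t≡T₁ t≡T₂
      , divides-δ b-1∣M (ℕ.n∣m*n (2 ^ q)) t≡T₁ t≡T₂)

    choose : Dec (∃ λ t → t < bad-bound × + t ≡ + T₁ [mod M ] × Bad t) →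
      ∃ λ T → ∀ t → + t ≡ + T [mod M ] → + P* ℤ.≤ k t ℤ.* + b ℤ.+ 1ℤ → IsBrier b (k t)
    choose (no none) = T₁ , λ t t≡T₁ large →
      proj₂ (proj₂ solution₁) t t≡T₁ large λ bad → none (t , bad-bounded bad , t≡T₁ , bad)
    -- The only bad t is now `t₁`, so a bad member of the class of `T₂` would also lie in the class
    -- of `T₁`.
    choose (yes (t₁ , _ , t₁≡T₁ , bad₁)) = T₂ , λ t t≡T₂ large →
      proj₂ (proj₂ solution₂) t t≡T₂ large λ bad →
        incongruent (ℤ.∣ᵤ⇒∣ (subst (λ t → + t ≡ + T₁ [mod M ]) (bad-unique bad₁ bad) t₁≡T₁)) (ℤ.∣ᵤ⇒∣ t≡T₂)

theorem3p5 :
  (b : ℕ) → 3 ≤ b → (∀ k → b + 1 ≢ 2 ^ k) →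
  (α : ℤ) → α ≢ 0ℤ →
  (q : ℕ) → Prime q → 5 ≤ q →
  (C₁ C₂ : CoveringSystem) →
  moduli C₁ ↭ moduli₁ q →
  moduli C₂ ↭ moduli₂ q →
  (P₁ : Primitive b C₁) (P₂ : Primitive b C₂) →
  let 𝒫 = primes P₁ ++ primes P₂
      M = lcmList ((2 ^ q ∷ 3 ^ q ∷ b ∸ 1 ∷ q ∷ []) ++ 𝒫)
  in
  Σ[ T ∈ ℤ ] ∀ (t : ℕ) → + t ≡ T [mod M ] →
    + max 0 𝒫 ℤ.≤ (+ (t * b ^ t) ℤ.+ α) ℤ.* + b ℤ.+ 1ℤ →
    IsBrier b (+ (t * b ^ t) ℤ.+ α)
theorem3p5 b b≥3 _ α _ q q-prime q≥5 C₁ C₂ C₁↭ C₂↭ P₁ P₂ = + proj₁ T , proj₂ T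
  where
  T = Brier.brier-class b b≥3 α q q-prime q≥5 C₁ C₂ C₁↭ C₂↭ P₁ P₂
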